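{- $\mathcal{V}$-completeness is undecidable for normal modal logics with at least three operators: for every $k\geq3$, there is no algorithm which, given a finite set of formulas of the polymodal language with $k$ box operators, decides whether the smallest normal polymodal logic containing those formulas is $\mathcal{V}$-complete.
   Context: A normal polymodal logic in the language with boxes $\Box_1,\dots,\Box_k$ is a set of formulas containing all classical tautologies and $\Box_i(p\to q)\to(\Box_ip\to\Box_iq)$ for each $i$, closed under modus ponens, uniform substitution, and necessitation for each $\Box_i$. A BAO for this language is a Boolean algebra with unary operations $\Diamond_1,\dots,\Diamond_k$, each preserving binary joins and $\bot$; $\Box_ix=\neg\Diamond_i\neg x$. It validates a formula if every assignment of elements to variables, extended homomorphically, sends the formula to $\top$. A $\mathcal{V}$-BAO is a BAO in which every operator $\Diamond_i$ is completely additive: for every set $X$ of elements, if $\bigvee X$ exists, then $\bigvee\{\Diamond_ix\mid x\in X\}$ exists and equals $\Diamond_i\bigvee X$. A normal logic is $\mathcal{V}$-complete if it is exactly the set of formulas validated by all members of some (possibly empty) class of $\mathcal{V}$-BAOs. -}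

module Defs where

open import Algebra.Lattice.Bundles using (BooleanAlgebra)
import Algebra.Lattice.Properties.Lattice as LatticeProperties
open import Data.Bool.Base using (Bool; true; false; not) renaming (_∨_ to _or_)
open import Data.Fin.Base using (Fin; zero; suc; toℕ)
open import Data.List.Base using (List; []; _∷_)
open import Data.List.Membership.Propositional using (_∈_)
open import Data.Maybe.Base using (Maybe; just; nothing)
open import Data.Nat.Base using (ℕ; zero; suc; pred; _*_; _^_)
open import Data.Nat.GeneralisedArithmetic using (iterate)
open import Data.Product.Base using (Σ-syntax; ∃-syntax; _×_; _,_)
open import Data.Vec.Base using (Vec; _∷_; lookup; head; replicate; updateAt)
open import Function.Bundles using (_⇔_)
open import Level using (Level; _⊔_) renaming (suc to lsuc)
open import Relation.Binary.Bundles using (Poset)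
open import Relation.Binary.PropositionalEquality.Core using (_≡_)
open import Relation.Nullary.Negation.Core using (¬_)
open import Relation.Unary using (Pred)

------------------------------------------------------------------------
-- Polymodal formulas and normal logics

infixr 6 _⇒_

data Formula (k : ℕ) : Set where
  var : ℕ → Formula k
  ⊥′  : Formula k
  _⇒_ : Formula k → Formula k → Formula k
  □   : Fin k → Formula k → Formula k

module _ {k : ℕ} where

  substitute : (ℕ → Formula k) → Formula k → Formula k
  substitute σ (var n) = σ n
  substitute σ ⊥′      = ⊥′
  substitute σ (φ ⇒ ψ) = substitute σ φ ⇒ substitute σ ψ
  substitute σ (□ i φ) = □ i (substitute σ φ)

  -- Variables and boxed formulas are the propositional atoms: v is only ever
  -- consulted on these.
  truth : (Formula k → Bool) → Formula k → Bool
  truth v (var n) = v (var n)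
  truth v ⊥′      = false
  truth v (φ ⇒ ψ) = not (truth v φ) or truth v ψ
  truth v (□ i φ) = v (□ i φ)

  Tautology : Formula k → Set
  Tautology φ = ∀ v → truth v φ ≡ true

  axiomK : Fin k → Formula k
  axiomK i = □ i (p ⇒ q) ⇒ (□ i p ⇒ □ i q)
    where
    p = var 0
    q = var 1

  record IsNormalLogic {a : Level} (L : Pred (Formula k) a) : Set a where
    field
      tautologies  : ∀ {φ} → Tautology φ → L φ
      K            : ∀ i → L (axiomK i)
      modusPonens  : ∀ {φ ψ} → L (φ ⇒ ψ) → L φ → L ψ
      substitution : ∀ σ {φ} → L φ → L (substitute σ φ)
      necessity    : ∀ i {φ} → L φ → L (□ i φ)

  data SmallestNormalLogic (Γ : List (Formula k)) : Pred (Formula k) Level.zero where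
    axiom        : ∀ {φ} → φ ∈ Γ → SmallestNormalLogic Γ φ
    tautologies  : ∀ {φ} → Tautology φ → SmallestNormalLogic Γ φ
    K            : ∀ i → SmallestNormalLogic Γ (axiomK i)
    modusPonens  : ∀ {φ ψ} → SmallestNormalLogic Γ (φ ⇒ ψ) →
                   SmallestNormalLogic Γ φ → SmallestNormalLogic Γ ψ
    substitution : ∀ σ {φ} → SmallestNormalLogic Γ φ →
                   SmallestNormalLogic Γ (substitute σ φ)
    necessity    : ∀ i {φ} → SmallestNormalLogic Γ φ →
                   SmallestNormalLogic Γ (□ i φ)

  smallest-isNormal : ∀ Γ → IsNormalLogic (SmallestNormalLogic Γ)
  smallest-isNormal Γ = record
    { tautologies  = tautologies
    ; K            = K
    ; modusPonens  = modusPonens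
    ; substitution = substitution
    ; necessity    = necessity
    }

  smallest-isLeast : ∀ {a} {L : Pred (Formula k) a} Γ → IsNormalLogic L →
                     (∀ {φ} → φ ∈ Γ → L φ) →
                     ∀ {φ} → SmallestNormalLogic Γ φ → L φ
  smallest-isLeast {L = L} Γ normal Γ⊆L = go
    where
    module N = IsNormalLogic normal
    go : ∀ {φ} → SmallestNormalLogic Γ φ → L φ
    go (axiom φ∈Γ)       = Γ⊆L φ∈Γ
    go (tautologies t)   = N.tautologies t
    go (K i)             = N.K i
    go (modusPonens d e) = N.modusPonens (go d) (go e)
    go (substitution σ d) = N.substitution σ (go d)
    go (necessity i d)   = N.necessity i (go d)

------------------------------------------------------------------------
-- Boolean algebras with operators

record BAO (k : ℕ) (c ℓ : Level) : Set (lsuc (c ⊔ ℓ)) where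
  field
    booleanAlgebra : BooleanAlgebra c ℓ

  open BooleanAlgebra booleanAlgebra public renaming (¬_ to ∁_)

  field
    ◇      : Fin k → Carrier → Carrier
    ◇-cong : ∀ i {x y} → x ≈ y → ◇ i x ≈ ◇ i y
    ◇-∨    : ∀ i x y → ◇ i (x ∨ y) ≈ ◇ i x ∨ ◇ i y
    ◇-⊥    : ∀ i → ◇ i ⊥ ≈ ⊥

  -- The lattice order, x ≤ y being x ≈ x ∧ y.
  open Poset (LatticeProperties.poset lattice) public using (_≤_)

  interpret : (ℕ → Carrier) → Formula k → Carrier
  interpret v (var n) = v n
  interpret v ⊥′      = ⊥
  interpret v (φ ⇒ ψ) = ∁ (interpret v φ) ∨ interpret v ψ
  interpret v (□ i φ) = ∁ (◇ i (∁ (interpret v φ)))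

  Validates : Formula k → Set (c ⊔ ℓ)
  Validates φ = ∀ v → interpret v φ ≈ ⊤

  -- Sets of elements are arbitrary predicates. They need not respect _≈_:
  -- a predicate and its closure under _≈_ have the same upper bounds.
  record IsJoin (X : Pred Carrier (c ⊔ ℓ)) (s : Carrier) : Set (c ⊔ ℓ) where
    field
      upper : ∀ x → X x → x ≤ s
      least : ∀ u → (∀ x → X x → x ≤ u) → s ≤ u

  ◇-image : Fin k → Pred Carrier (c ⊔ ℓ) → Pred Carrier (c ⊔ ℓ)
  ◇-image i X y = ∃[ x ] (X x × y ≈ ◇ i x)

  CompletelyAdditive : Fin k → Set (lsuc (c ⊔ ℓ))
  CompletelyAdditive i = ∀ (X : Pred Carrier (c ⊔ ℓ)) s →
                         IsJoin X s → IsJoin (◇-image i X) (◇ i s)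

record 𝒱-BAO (k : ℕ) (c ℓ : Level) : Set (lsuc (c ⊔ ℓ)) where
  field
    bao                : BAO k c ℓ
    completelyAdditive : ∀ i → BAO.CompletelyAdditive bao i

  open BAO bao public

-- c and ℓ bound the size of the algebras, p that of the defining predicate of
-- the class.
𝒱-Complete : ∀ {k a} (c ℓ p : Level) → Pred (Formula k) a →
             Set (a ⊔ lsuc (c ⊔ ℓ ⊔ p))
𝒱-Complete {k} c ℓ p L =
  Σ[ 𝒦 ∈ Pred (𝒱-BAO k c ℓ) p ]
    (∀ φ → L φ ⇔ (∀ A → 𝒦 A → 𝒱-BAO.Validates A φ))

------------------------------------------------------------------------
-- Algorithms: Minsky register machines, which compute exactly the partial
-- recursive functions

-- An instruction of a machine with m registers and n instructions. Jump targets
-- are instruction numbers, with nothing meaning "halt".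
data Instruction (m n : ℕ) : Set where
  -- increment r, then jump to l
  inc : (r : Fin m) (l : Maybe (Fin n)) → Instruction m n
  -- if r is zero jump to l₀, otherwise decrement r and jump to l₁
  dec : (r : Fin m) (l₀ l₁ : Maybe (Fin n)) → Instruction m n

-- There are 1 + m registers, so that register 0, used for input and output,
-- exists, and 1 + n instructions, execution starting at instruction 0.
record Machine : Set where
  field
    m n     : ℕ
    program : Vec (Instruction (suc m) (suc n)) (suc n)

  Configuration : Set
  Configuration = Maybe (Fin (suc n)) × Vec ℕ (suc m)

  execute : Instruction (suc m) (suc n) → Vec ℕ (suc m) → Configuration
  execute (inc r l)     ρ = l , updateAt ρ r suc
  execute (dec r l₀ l₁) ρ with lookup ρ r
  ... | zero  = l₀ , ρ
  ... | suc _ = l₁ , updateAt ρ r pred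

  step : Configuration → Configuration
  step (nothing , ρ) = nothing , ρ
  step (just l  , ρ) = execute (lookup program l) ρ

  initial : ℕ → Configuration
  initial x = just zero , x ∷ replicate m 0

  -- On input x the machine halts with output y.
  _↦_ : ℕ → ℕ → Set
  x ↦ y = ∃[ t ] ∃[ ρ ] (iterate step (initial x) t ≡ (nothing , ρ) × head ρ ≡ y)

-- Finite sets of formulas are presented to machines as lists, coded by the
-- bijection (x , y) ↦ 2ˣ (2y + 1) between pairs and positive numbers; 0 is left
-- for ⊥′ and for [].

⟨_,_⟩ : ℕ → ℕ → ℕ
⟨ x , y ⟩ = 2 ^ x * suc (2 * y)

codeFormula : ∀ {k} → Formula k → ℕ
codeFormula ⊥′      = 0
codeFormula (var n) = ⟨ 0 , n ⟩
codeFormula (φ ⇒ ψ) = ⟨ 1 , ⟨ codeFormula φ , codeFormula ψ ⟩ ⟩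
codeFormula (□ i φ) = ⟨ suc (suc (toℕ i)) , codeFormula φ ⟩

code : ∀ {k} → List (Formula k) → ℕ
code []      = 0
code (φ ∷ Γ) = ⟨ codeFormula φ , code Γ ⟩

-- The machine answers 1 when P holds and 0 when it fails; classically, it thus
-- halts on every input. Stating this by two implications rather than by a
-- disjunction asks no more of a decision procedure than its answers, and so
-- makes undecidability constructively as strong as possible.
Decides : ∀ {k a} → Machine → Pred (List (Formula k)) a → Set a
Decides M P = ∀ Γ → (P Γ → code Γ ↦ 1) × (¬ P Γ → code Γ ↦ 0)
  where open Machine M

{-# OPTIONS --safe #-}
module Submission where

-- The logic with axioms □₁(□₁p → p) → □₁p, □₂(□₁p → p) and ¬□₂⊥ has no nontrivial
-- 𝒱-BAO: the elements ¬(□₁u → u) have join ⊤ and are all annihilated by ◇₂. It is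
-- nevertheless consistent: on ℕ take □₁p = "p everywhere below" and □₂p = "p almost
-- everywhere". Hence, for a finite Γ containing these axioms, the logic of Γ is
-- 𝒱-complete if and only if it is inconsistent.
--
-- For a machine M we find such a Γ whose other axioms, using □₀, describe the
-- computation of M on the code of Γ itself, and make the logic inconsistent if the
-- output is 0. If it is 1, the finitely many states visited can be hung on the model
-- above, the later ones below the earlier ones, so the logic is consistent. In both
-- cases M is wrong. Self-reference is achieved by a front end which computes the code
-- of Γ from a number x, used as a placeholder for the code of the axioms that do not
-- mention x.

open import Defs

import Algebra.Lattice.Properties.BooleanAlgebra as BooleanProperties
open import Data.Bool.Base using (Bool; true; false; not; T) renaming (_∧_ to _and_; _∨_ to _or_)
open import Data.Bool.ListAction using (all)
open import Data.Bool.Properties using (T-∧)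
import Data.Bool.Properties as Bool
open import Data.Empty using (⊥-elim) renaming (⊥ to Empty)
open import Data.Fin.Base using (Fin; zero; suc; toℕ; _↑ʳ_)
open import Data.Fin.Patterns using (0F; 1F; 2F; 3F; 4F; 5F)
open import Data.Fin.Properties using (_≟_; toℕ-injective)
open import Data.List.Base using (List; []; _∷_; concatMap; allFin; tabulate)
open import Data.List.Membership.Propositional using (_∈_; find; lose)
open import Data.List.Membership.Propositional.Properties
  using (∈-concatMap⁺; ∈-concatMap⁻; ∈-allFin; ∈-tabulate⁺; ∈-tabulate⁻)
import Data.List.Relation.Unary.All as All
open import Data.List.Relation.Unary.All.Properties using (all⁺; all⁻)
open import Data.List.Relation.Unary.Any using (here; there)
open import Data.Maybe.Base using (Maybe; just; nothing)
open import Data.Nat.Base using (ℕ; zero; suc; pred; _+_; _*_; _^_; _∸_; _⊔_; _≤_; _<_; _≥_; _<ᵇ_; z≤n; s≤s; s≤s⁻¹)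
open import Data.Nat.GeneralisedArithmetic using (fold; fold-+; iterate; iterate-is-fold)
import Data.Nat.Properties as ℕ
open import Data.Nat.Tactic.RingSolver using (solve-∀)
open import Data.Product.Base using (∃-syntax; _×_; _,_; proj₁; proj₂)
open import Data.Sum.Base using (_⊎_; inj₁; inj₂)
open import Data.Unit.Base using (tt)
open import Data.Vec.Base using (Vec; []; _∷_; lookup; map; head; replicate; updateAt)
import Data.Vec.Functional as F
import Data.Vec.Functional.Properties as F
open import Data.Vec.Properties
  using (lookup-map; lookup-replicate; lookup∘updateAt; lookup∘updateAt′; updateAt-updateAt; updateAt-id-local)
open import Function.Base using (_∘_; const; id)
open import Function.Bundles using (Equivalence; mk⇔)
open import Level using (Level; Lift; lift)
open import Relation.Binary.PropositionalEquality.Core using (_≡_; _≢_; refl; sym; trans; cong; cong₂; subst)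
import Relation.Binary.Reasoning.Setoid as SetoidReasoning
open import Relation.Nullary.Decidable.Core using (yes; no)
open import Relation.Nullary.Negation.Core using (¬_; contradiction)
open import Relation.Unary using (Pred)

-- A 𝒱-incomplete logic

module _ {k : ℕ} where

  löb : Formula (3 + k)
  löb = □ (suc zero) (□ (suc zero) (var 0) ⇒ var 0) ⇒ □ (suc zero) (var 0)

  reflection : Formula (3 + k)
  reflection = □ (suc (suc zero)) (□ (suc zero) (var 0) ⇒ var 0)

  serial : Formula (3 + k)
  serial = □ (suc (suc zero)) ⊥′ ⇒ ⊥′

  module _ {c ℓ} (A : 𝒱-BAO (3 + k) c ℓ) where
    open 𝒱-BAO A renaming (refl to ≈-refl; sym to ≈-sym; trans to ≈-trans; _≤_ to _⊑_)
    open BooleanProperties booleanAlgebra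
    open SetoidReasoning setoid

    -- The elements x = ¬(□₁u → u) have join ⊤: an upper bound u of them satisfies
    -- □₁u → u = ⊤, hence u = ⊤ by Löb. As ◇₂ x = ⊥ for each of them, complete
    -- additivity yields ◇₂ ⊤ = ⊥.
    degenerate : Validates löb → Validates reflection → Validates serial → ⊤ ≈ ⊥
    degenerate ⊨löb ⊨reflection ⊨serial = begin
      ⊤                   ≈⟨ ⊨serial (λ _ → ⊥) ⟨
      ∁ ∁ ◇₂ (∁ ⊥) ∨ ⊥    ≈⟨ ∨-identityʳ _ ⟩
      ∁ ∁ ◇₂ (∁ ⊥)        ≈⟨ ¬-involutive _ ⟩
      ◇₂ (∁ ⊥)            ≈⟨ ◇-cong (suc (suc zero)) ¬⊥≈⊤ ⟩
      ◇₂ ⊤                ≈⟨ IsJoin.least additive ⊥ below ⟩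
      ◇₂ ⊤ ∧ ⊥            ≈⟨ ∧-zeroʳ _ ⟩
      ⊥                   ∎
      where
      ◇₁ = ◇ (suc zero)
      ◇₂ = ◇ (suc (suc zero))

      □₁ : Carrier → Carrier
      □₁ x = ∁ ◇₁ (∁ x)

      ρ : Carrier → Carrier
      ρ u = ∁ □₁ u ∨ u

      X : Pred Carrier _
      X x = ∃[ u ] x ≈ ∁ ρ u

      □₁⊤ : ∀ {x} → x ≈ ⊤ → □₁ x ≈ ⊤
      □₁⊤ {x} x≈⊤ = begin
        ∁ ◇₁ (∁ x)  ≈⟨ ¬-cong (◇-cong (suc zero) (≈-trans (¬-cong x≈⊤) ¬⊤≈⊥)) ⟩
        ∁ ◇₁ ⊥      ≈⟨ ¬-cong (◇-⊥ (suc zero)) ⟩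
        ∁ ⊥         ≈⟨ ¬⊥≈⊤ ⟩
        ⊤           ∎

      detach : ∀ {x y} → x ≈ ⊤ → ∁ x ∨ y ≈ ⊤ → y ≈ ⊤
      detach {x} {y} x≈⊤ x⇒y = begin
        y        ≈⟨ ∨-identityˡ y ⟨
        ⊥ ∨ y    ≈⟨ ∨-congʳ (≈-trans (¬-cong x≈⊤) ¬⊤≈⊥) ⟨
        ∁ x ∨ y  ≈⟨ x⇒y ⟩
        ⊤        ∎

      -- `∁ ρ u` is `□₁ u ∧ ∁ u`, hence disjoint from `u`; lying below `u`, it can only be `⊥`.
      ρ≈⊤ : ∀ {u} → ∁ ρ u ⊑ u → ρ u ≈ ⊤
      ρ≈⊤ {u} ¬ρ≤u = begin
        ρ u                    ≈⟨ ¬-involutive _ ⟨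
        ∁ ∁ ρ u                ≈⟨ ¬-cong ¬ρu≈⊥ ⟩
        ∁ ⊥                    ≈⟨ ¬⊥≈⊤ ⟩
        ⊤                      ∎
        where
        ¬ρu≈⊥ : ∁ ρ u ≈ ⊥
        ¬ρu≈⊥ = begin
          ∁ ρ u                  ≈⟨ ¬ρ≤u ⟩
          ∁ ρ u ∧ u              ≈⟨ ∧-congʳ (deMorgan₂ _ u) ⟩
          (∁ ∁ □₁ u ∧ ∁ u) ∧ u   ≈⟨ ∧-assoc _ _ u ⟩
          ∁ ∁ □₁ u ∧ (∁ u ∧ u)   ≈⟨ ∧-congˡ (∧-complementˡ u) ⟩
          ∁ ∁ □₁ u ∧ ⊥           ≈⟨ ∧-zeroʳ _ ⟩
          ⊥                      ∎

      join : IsJoin X ⊤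
      join = record
        { upper = λ x _ → ≈-sym (∧-identityʳ x)
        ; least = λ u bound →
            let ρu≈⊤ = ρ≈⊤ (bound _ (u , ≈-refl))
                u≈⊤  = detach (detach (□₁⊤ ρu≈⊤) (⊨löb (λ _ → u))) ρu≈⊤
            in ≈-sym (≈-trans (∧-congˡ u≈⊤) (∧-identityʳ ⊤))
        }

      additive : IsJoin (◇-image (suc (suc zero)) X) (◇₂ ⊤)
      additive = completelyAdditive (suc (suc zero)) X ⊤ join

      below : ∀ y → ◇-image (suc (suc zero)) X y → y ⊑ ⊥
      below y (x , (u , x≈¬ρu) , y≈◇x) = begin
        y          ≈⟨ y≈◇x ⟩
        ◇₂ x       ≈⟨ ◇-cong (suc (suc zero)) x≈¬ρu ⟩
        ◇₂ (∁ ρ u) ≈⟨ ¬-involutive _ ⟨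
        ∁ ∁ ◇₂ (∁ ρ u) ≈⟨ ¬-cong (⊨reflection (λ _ → u)) ⟩
        ∁ ⊤        ≈⟨ ¬⊤≈⊥ ⟩
        ⊥          ≈⟨ ∧-zeroʳ y ⟨
        y ∧ ⊥      ∎

-- Counter programs

data CounterInstruction (R L : ℕ) : Set where
  add           : (r : Fin R) (k : ℕ) (l : Fin L) → CounterInstruction R L
  branch        : (r : Fin R) (l₀ l₁ : Fin L) → CounterInstruction R L
  accept reject : CounterInstruction R L

module CounterProgram {R L : ℕ} (program : Vec (CounterInstruction R L) L) where

  State : Set
  State = Fin L × Vec ℕ R

  run : CounterInstruction R L → State → State
  run (add r k l) (_ , ρ) = l , updateAt ρ r (k +_)
  run (branch r l₀ l₁) (_ , ρ) with lookup ρ r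
  ... | zero  = l₀ , ρ
  ... | suc _ = l₁ , updateAt ρ r pred
  run accept s = s
  run reject s = s

  next : State → State
  next (l , ρ) = run (lookup program l) (l , ρ)

  infix  4 _⟶*_
  infixr 5 _▻_

  data _⟶*_ : State → State → Set where
    stop : ∀ {s} → s ⟶* s
    go   : ∀ {s t} → next s ⟶* t → s ⟶* t

  to-≡ : ∀ {s t u} → s ⟶* t → t ≡ u → s ⟶* u
  to-≡ d refl = d

  go-≡ : ∀ {s t u} → next s ≡ t → t ⟶* u → s ⟶* u
  go-≡ refl = go

  _▻_ : ∀ {s t u} → s ⟶* t → t ⟶* u → s ⟶* u
  stop ▻ d = d
  go e ▻ d = go (e ▻ d)

  ⟶*⇒iterate : ∀ {s t} → s ⟶* t → ∃[ n ] iterate next s n ≡ t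
  ⟶*⇒iterate stop   = 0 , refl
  ⟶*⇒iterate (go e) with n , eq ← ⟶*⇒iterate e = suc n , eq

-- A counter program computing, from x, the number ⟨ ⟨ 1 , ⟨ b x , f ⟩ ⟩ , x ⟩
-- with b 0 = c and b (1 + n) = β + b n * α, and then running M on it. The
-- registers are x, y, the result b y, two auxiliary ones and those of M.
module FrontEnd (M : Machine) (c α β f : ℕ) where
  open Machine M

  R L : ℕ
  R = 5 + suc m
  L = 28 + suc n

  target : Maybe (Fin (suc n)) → Fin L
  target nothing  = 25 ↑ʳ zero
  target (just l) = 28 ↑ʳ l

  translate : Instruction (suc m) (suc n) → CounterInstruction R L
  translate (inc r l)     = add (5 ↑ʳ r) 1 (target l)
  translate (dec r l₀ l₁) = branch (5 ↑ʳ r) (target l₀) (target l₁)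

  -- Instructions 0 to 7 put `b x` into register 2 and `x` into register 1; 8 to 13 form e =
  -- `⟨ b x , f ⟩` in register 3; 14 to 16 turn it into 2 + 4e = `⟨ 1 , e ⟩` in register 2; 17 to 24
  -- multiply 2x + 1 by 2 to that power. `M` starts at 28 and halts into the test at 25, where
  -- output 0 is rejected and any other output accepted.
  simulation : Vec (CounterInstruction R L) L
  simulation =
    {- 0 -} add 2F c (1 ↑ʳ zero) ∷
    {- 1 -} branch 0F (8 ↑ʳ zero) (2 ↑ʳ zero) ∷
    {- 2 -} add 1F 1 (3 ↑ʳ zero) ∷
    {- 3 -} branch 2F (5 ↑ʳ zero) (4 ↑ʳ zero) ∷
    {- 4 -} add 4F α (3 ↑ʳ zero) ∷
    {- 5 -} branch 4F (7 ↑ʳ zero) (6 ↑ʳ zero) ∷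
    {- 6 -} add 2F 1 (5 ↑ʳ zero) ∷
    {- 7 -} add 2F β (1 ↑ʳ zero) ∷
    {- 8 -} add 3F (suc (2 * f)) (9 ↑ʳ zero) ∷
    {- 9 -} branch 2F (14 ↑ʳ zero) (10 ↑ʳ zero) ∷
    {- 10 -} branch 3F (12 ↑ʳ zero) (11 ↑ʳ zero) ∷
    {- 11 -} add 4F 2 (10 ↑ʳ zero) ∷
    {- 12 -} branch 4F (9 ↑ʳ zero) (13 ↑ʳ zero) ∷
    {- 13 -} add 3F 1 (12 ↑ʳ zero) ∷
    {- 14 -} branch 3F (16 ↑ʳ zero) (15 ↑ʳ zero) ∷
    {- 15 -} add 2F 4 (14 ↑ʳ zero) ∷
    {- 16 -} add 2F 2 (17 ↑ʳ zero) ∷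
    {- 17 -} add 5F 1 (18 ↑ʳ zero) ∷
    {- 18 -} branch 1F (20 ↑ʳ zero) (19 ↑ʳ zero) ∷
    {- 19 -} add 5F 2 (18 ↑ʳ zero) ∷
    {- 20 -} branch 2F (28 ↑ʳ zero) (21 ↑ʳ zero) ∷
    {- 21 -} branch 5F (23 ↑ʳ zero) (22 ↑ʳ zero) ∷
    {- 22 -} add 4F 2 (21 ↑ʳ zero) ∷
    {- 23 -} branch 4F (20 ↑ʳ zero) (24 ↑ʳ zero) ∷
    {- 24 -} add 5F 1 (23 ↑ʳ zero) ∷
    {- 25 -} branch 5F (27 ↑ʳ zero) (26 ↑ʳ zero) ∷
    {- 26 -} accept ∷
    {- 27 -} reject ∷
    map translate program

  open CounterProgram simulation

  initialState : ℕ → State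
  initialState x = zero , x ∷ replicate _ 0

  embed : Configuration → State
  embed (l , ρ) = target l , 0 ∷ 0 ∷ 0 ∷ 0 ∷ 0 ∷ ρ

  next-embed : ∀ l ρ → next (embed (just l , ρ)) ≡ embed (step (just l , ρ))
  next-embed l ρ rewrite lookup-map l translate program with lookup program l
  ... | inc r l′     = refl
  ... | dec r l₀ l₁ with lookup ρ r
  ...   | zero  = refl
  ...   | suc _ = refl

  simulate : ∀ t C → embed C ⟶* embed (iterate step C t)
  simulate zero    C              = stop
  simulate (suc t) (nothing , ρ) = simulate t (nothing , ρ)
  simulate (suc t) (just l , ρ)  =
    go-≡ (next-embed l ρ) (simulate t (step (just l , ρ)))

  verdict : ℕ → Fin L
  verdict zero    = 27 ↑ʳ zero
  verdict (suc _) = 26 ↑ʳ zero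

  finish : ∀ ρ → ∃[ σ ] (embed (nothing , ρ) ⟶* (verdict (head ρ) , σ))
  finish (zero  ∷ ρ) = _ , go stop
  finish (suc _ ∷ ρ) = _ , go stop

  b : ℕ → ℕ
  b zero    = c
  b (suc n) = β + b n * α

  -- Correctness of the front end

  private
    at : Fin L → (x y z u v w : ℕ) → Vec ℕ m → State
    at l x y z u v w ρ = l , x ∷ y ∷ z ∷ u ∷ v ∷ w ∷ ρ

    rearrange : ∀ a b c → (a + b) + c ≡ b + (a + c)
    rearrange = solve-∀

  scale : ∀ {x y u w ρ} z v → at (3 ↑ʳ zero) x y z u v w ρ ⟶* at (5 ↑ʳ zero) x y 0 u (v + z * α) w ρ
  scale {x} {y} {u} {w} {ρ} zero    v =
    to-≡ (go stop) (cong (λ r → at (5 ↑ʳ zero) x y 0 u r w ρ) (sym (ℕ.+-identityʳ v)))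
  scale {x} {y} {u} {w} {ρ} (suc z) v =
    to-≡ (go (go (scale z (α + v)))) (cong (λ r → at (5 ↑ʳ zero) x y 0 u r w ρ) (rearrange α v (z * α)))

  unload : ∀ {x y u w ρ} v z → at (5 ↑ʳ zero) x y z u v w ρ ⟶* at (7 ↑ʳ zero) x y (v + z) u 0 w ρ
  unload zero    z = go stop
  unload {x} {y} {u} {w} {ρ} (suc v) z =
    to-≡ (go (go (unload v (suc z)))) (cong (λ r → at (7 ↑ʳ zero) x y r u 0 w ρ) (ℕ.+-suc v z))

  -- Loop invariant: the result register holds `b y` for the number `y` of rounds done. Afterwards
  -- `y` preserves the input, which the countdown has destroyed and which is still needed as the
  -- second component of the pair.
  iterated : ∀ {u w ρ} x y → at (1 ↑ʳ zero) x y (b y) u 0 w ρ ⟶* at (8 ↑ʳ zero) 0 (x + y) (b (x + y)) u 0 w ρ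
  iterated zero    y = go stop
  iterated {u} {w} {ρ} (suc x) y =
    go (go (scale (b y) 0 ▻ unload (b y * α) 0 ▻ go (
    to-≡ (iter (cong (β +_) (ℕ.+-identityʳ (b y * α))))
         (cong (λ n → at (8 ↑ʳ zero) 0 n (b n) u 0 w ρ) (ℕ.+-suc x y)))))
    where
    iter : ∀ {z} → z ≡ b (suc y) → at (1 ↑ʳ zero) x (suc y) z u 0 w ρ ⟶*
                               at (8 ↑ʳ zero) 0 (x + suc y) (b (x + suc y)) u 0 w ρ
    iter refl = iterated x (suc y)

  double : ∀ {x y z w ρ} u v → at (10 ↑ʳ zero) x y z u v w ρ ⟶* at (12 ↑ʳ zero) x y z 0 (v + u * 2) w ρ
  double {x} {y} {z} {w} {ρ} zero    v =
    to-≡ (go stop) (cong (λ r → at (12 ↑ʳ zero) x y z 0 r w ρ) (sym (ℕ.+-identityʳ v)))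
  double {x} {y} {z} {w} {ρ} (suc u) v =
    to-≡ (go (go (double u (2 + v)))) (cong (λ r → at (12 ↑ʳ zero) x y z 0 r w ρ) (rearrange 2 v (u * 2)))

  restore : ∀ {x y z w ρ} v u → at (12 ↑ʳ zero) x y z u v w ρ ⟶* at (9 ↑ʳ zero) x y z (v + u) 0 w ρ
  restore zero    u = go stop
  restore {x} {y} {z} {w} {ρ} (suc v) u =
    to-≡ (go (go (restore v (suc u)))) (cong (λ r → at (9 ↑ʳ zero) x y z r 0 w ρ) (ℕ.+-suc v u))

  exponential : ∀ {x y w ρ} z u → at (9 ↑ʳ zero) x y z u 0 w ρ ⟶* at (14 ↑ʳ zero) x y 0 (2 ^ z * u) 0 w ρ
  exponential {x} {y} {w} {ρ} zero u =
    to-≡ (go stop) (cong (λ r → at (14 ↑ʳ zero) x y 0 r 0 w ρ) (sym (ℕ.+-identityʳ u)))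
  exponential {x} {y} {w} {ρ} (suc z) u =
    go (double u 0 ▻ restore (u * 2) 0 ▻
    to-≡ (exponential z (u * 2 + 0)) (cong (λ r → at (14 ↑ʳ zero) x y 0 r 0 w ρ) (lemma (2 ^ z) u)))
    where
    lemma : ∀ a u → a * (u * 2 + 0) ≡ 2 * a * u
    lemma = solve-∀

  quadruple : ∀ {x y v w ρ} u z → at (14 ↑ʳ zero) x y z u v w ρ ⟶* at (16 ↑ʳ zero) x y (u * 4 + z) 0 v w ρ
  quadruple zero    z = go stop
  quadruple {x} {y} {v} {w} {ρ} (suc u) z =
    to-≡ (go (go (quadruple u (4 + z)))) (cong (λ r → at (16 ↑ʳ zero) x y r 0 v w ρ) (lemma u z))
    where
    lemma : ∀ u z → u * 4 + (4 + z) ≡ 4 + u * 4 + z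
    lemma = solve-∀

  odd : ∀ {x z u v ρ} y w → at (18 ↑ʳ zero) x y z u v w ρ ⟶* at (20 ↑ʳ zero) x 0 z u v (y * 2 + w) ρ
  odd zero    w = go stop
  odd {x} {z} {u} {v} {ρ} (suc y) w =
    to-≡ (go (go (odd y (2 + w)))) (cong (λ r → at (20 ↑ʳ zero) x 0 z u v r ρ) (lemma y w))
    where
    lemma : ∀ u z → u * 2 + (2 + z) ≡ 2 + u * 2 + z
    lemma = solve-∀

  double′ : ∀ {x y z u ρ} w v → at (21 ↑ʳ zero) x y z u v w ρ ⟶* at (23 ↑ʳ zero) x y z u (v + w * 2) 0 ρ
  double′ {x} {y} {z} {u} {ρ} zero    v =
    to-≡ (go stop) (cong (λ r → at (23 ↑ʳ zero) x y z u r 0 ρ) (sym (ℕ.+-identityʳ v)))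
  double′ {x} {y} {z} {u} {ρ} (suc w) v =
    to-≡ (go (go (double′ w (2 + v)))) (cong (λ r → at (23 ↑ʳ zero) x y z u r 0 ρ) (rearrange 2 v (w * 2)))

  restore′ : ∀ {x y z u ρ} v w → at (23 ↑ʳ zero) x y z u v w ρ ⟶* at (20 ↑ʳ zero) x y z u 0 (v + w) ρ
  restore′ zero    w = go stop
  restore′ {x} {y} {z} {u} {ρ} (suc v) w =
    to-≡ (go (go (restore′ v (suc w)))) (cong (λ r → at (20 ↑ʳ zero) x y z u 0 r ρ) (ℕ.+-suc v w))

  exponential′ : ∀ {x y u ρ} z w → at (20 ↑ʳ zero) x y z u 0 w ρ ⟶* at (28 ↑ʳ zero) x y 0 u 0 (2 ^ z * w) ρ
  exponential′ {x} {y} {u} {ρ} zero w =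
    to-≡ (go stop) (cong (λ r → at (28 ↑ʳ zero) x y 0 u 0 r ρ) (sym (ℕ.+-identityʳ w)))
  exponential′ {x} {y} {u} {ρ} (suc z) w =
    go (double′ w 0 ▻ restore′ (w * 2) 0 ▻
    to-≡ (exponential′ z (w * 2 + 0)) (cong (λ r → at (28 ↑ʳ zero) x y 0 u 0 r ρ) (lemma (2 ^ z) w)))
    where
    lemma : ∀ a u → a * (u * 2 + 0) ≡ 2 * a * u
    lemma = solve-∀

  compute : ∀ x → initialState x ⟶* embed (initial ⟨ ⟨ 1 , ⟨ b x , f ⟩ ⟩ , x ⟩)
  compute x =
    to-≡ (go stop) (cong (λ r → at (1 ↑ʳ zero) x 0 r 0 0 0 ρ₀) (ℕ.+-identityʳ c)) ▻
    to-≡ (iterated x 0) (cong (λ r → at (8 ↑ʳ zero) 0 r (b r) 0 0 0 ρ₀) (ℕ.+-identityʳ x)) ▻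
    go (to-≡ (exponential (b x) (suc (2 * f) + 0))
             (cong (λ r → at (14 ↑ʳ zero) 0 x 0 (2 ^ b x * r) 0 0 ρ₀) (ℕ.+-identityʳ (suc (2 * f))))) ▻
    quadruple ⟨ b x , f ⟩ 0 ▻
    go (go (odd x 1 ▻
    to-≡ (exponential′ (2 + (⟨ b x , f ⟩ * 4 + 0)) (x * 2 + 1))
         (cong (λ r → at (28 ↑ʳ zero) 0 0 0 0 0 r ρ₀)
               (cong₂ (λ i j → 2 ^ i * j) (exponent ⟨ b x , f ⟩) (factor x)))))
    where
    ρ₀ = replicate m 0
    exponent : ∀ e → 2 + (e * 4 + 0) ≡ 2 * (1 + 2 * e)
    exponent = solve-∀
    factor : ∀ e → e * 2 + 1 ≡ 1 + 2 * e
    factor = solve-∀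

  reaches-verdict : ∀ {x i y} → i ≡ ⟨ ⟨ 1 , ⟨ b x , f ⟩ ⟩ , x ⟩ → i ↦ y →
                    ∃[ σ ] (initialState x ⟶* (verdict y , σ))
  reaches-verdict {x} refl (t , ρ , eq , refl) with σ , d ← finish ρ =
    σ , compute x ▻ to-≡ (simulate t _) (cong embed eq) ▻ d

-- Computations described by formulas

module Formulas (k : ℕ) where

  Fm : Set
  Fm = Formula (3 + k)

  infix 15 ~_
  ~_ : Fm → Fm
  ~ φ = φ ⇒ ⊥′

  □₀ □₁ □₂ : Fm → Fm
  □₀ = □ zero
  □₁ = □ (suc zero)
  □₂ = □ (suc (suc zero))

  -- Excludes the labels, so that `S` only looks at the predecessor of a number.
  guard : Fm
  guard = ~ □₀ ⊥′

  -- In the intended model a number n is a world with an edge to n ∸ 1, if n > 0,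
  -- and one to a label, labels having no successors. A formula represents n if n
  -- is the only number where it fails.
  S : Fm → Fm
  S φ = □₀ (guard ⇒ φ)

  -- Among the numbers it fails only at 0, whose sole edge leads to a label and thus to a dead end.
  Z : Fm
  Z = ~ □₀ (□₀ ⊥′)

  numeral : ℕ → Fm
  numeral n = fold Z S n

  -- Fails, among the worlds without □₀-successors, exactly at those of rank 1 + n
  -- with respect to □₁.
  unlabelled : ℕ → Fm
  unlabelled n = □₀ ⊥′ ⇒ fold ⊥′ □₁ (2 + n) ⇒ fold ⊥′ □₁ (1 + n)

  marked : ℕ → Fm
  marked n = ~ □₀ (unlabelled n)

  ⋁ : ∀ {n} → (Fin n → Fm) → Fm
  ⋁ {zero}  φ = ⊥′
  ⋁ {suc n} φ = ~ φ zero ⇒ ⋁ (φ ∘ suc)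

  -- To be read: no state visited with label l has, for all i, a number at which
  -- φ i fails in register i. States are worlds with edges to their label and to
  -- the contents of their registers.
  unvisited : ∀ {R L} → Fin L → (Fin R → Fm) → Fm
  unvisited l φ = □₁ (marked (toℕ l) ⇒ ⋁ (λ i → □₀ (marked (toℕ i) ⇒ φ i)))

  -- The only □₁-minimal world has a single edge, to the input.
  source : Fm
  source = □₁ ⊥′

  pointer : ℕ → Fm
  pointer x = numeral (suc x) ⇒ ~ source

  vars : ∀ {R} → Fin R → Fm
  vars i = var (toℕ i)

  -- The contrapositive of: if a state with label l has been visited, then so has
  -- its successor, with label l′.
  transition : ∀ {R L} → Fin R → Fin L → (Fm → Fm) → Fin L → (Fm → Fm) → Fm
  transition r l f l′ g = unvisited l′ (F.updateAt vars r g) ⇒ unvisited l (F.updateAt vars r f)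

  rules : ∀ {R L} → Fin L → CounterInstruction R L → List Fm
  rules l (add r n l′)            = transition r l id l′ (λ φ → fold φ S n) ∷ []
  rules l (branch r l₀ l₁)        = transition r l (const Z) l₀ (const Z) ∷ transition r l S l₁ id ∷ []
  rules l accept                  = []
  rules {R} l reject              = unvisited l (vars {R}) ∷ []

  input : ∀ {R} → Fm → Fin (suc R) → Fm
  input φ zero    = φ
  input φ (suc i) = Z

  -- It expresses that the initial state has been visited, with the number at which the source
  -- points in register 0: where `S (var 0)` fails at the source, `var 0` fails at that number.
  -- Putting `numeral x` for `var 0` turns the inner box into `□₁ (pointer x)`, so that only
  -- `pointer x` has to mention `x`.
  start : ∀ {L} ℕ → Fin L → Fm
  start R l = □₂ (unvisited l (input {R} (var 0)) ⇒ □₁ (S (var 0) ⇒ ~ source) ⇒ ⊥′)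

  module _ {R L : ℕ} (program : Vec (CounterInstruction (suc R) (suc L)) (suc L)) where

    background : List Fm
    background = löb ∷ reflection ∷ serial ∷ start R (zero {L}) ∷
                 concatMap (λ l → rules l (lookup program l)) (allFin (suc L))

    axioms : ℕ → List Fm
    axioms x = pointer x ∷ background

  -- Substitution in the formulas for computations

  substitute-fold : ∀ σ (s : Fm → Fm) → (∀ φ → substitute σ (s φ) ≡ s (substitute σ φ)) →
                    ∀ n φ → substitute σ (fold φ s n) ≡ fold (substitute σ φ) s n
  substitute-fold σ s hom zero    φ = refl
  substitute-fold σ s hom (suc n) φ = trans (hom _) (cong s (substitute-fold σ s hom n φ))

  substitute-marked : ∀ σ n → substitute σ (marked n) ≡ marked n
  substitute-marked σ n = cong (λ φ → ~ □₀ (□₀ ⊥′ ⇒ □₁ φ ⇒ φ)) (substitute-fold σ □₁ (λ _ → refl) (1 + n) ⊥′)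

  ⋁-cong : ∀ {n} {φ ψ : Fin n → Fm} → (∀ i → φ i ≡ ψ i) → ⋁ φ ≡ ⋁ ψ
  ⋁-cong {zero}  eq = refl
  ⋁-cong {suc n} eq = cong₂ (λ φ ψ → ~ φ ⇒ ψ) (eq zero) (⋁-cong (eq ∘ suc))

  substitute-⋁ : ∀ σ {n} (φ : Fin n → Fm) → substitute σ (⋁ φ) ≡ ⋁ (substitute σ ∘ φ)
  substitute-⋁ σ {zero}  φ = refl
  substitute-⋁ σ {suc n} φ = cong (~ substitute σ (φ zero) ⇒_) (substitute-⋁ σ (φ ∘ suc))

  unvisited-cong : ∀ {R L} (l : Fin L) {φ ψ : Fin R → Fm} → (∀ i → φ i ≡ ψ i) → unvisited l φ ≡ unvisited l ψ
  unvisited-cong l eq =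
    cong (λ χ → □₁ (marked (toℕ l) ⇒ χ)) (⋁-cong (λ i → cong (λ χ → □₀ (marked (toℕ i) ⇒ χ)) (eq i)))

  substitute-unvisited : ∀ σ {R L} (l : Fin L) {φ ψ : Fin R → Fm} → (∀ i → substitute σ (φ i) ≡ ψ i) →
                         substitute σ (unvisited l φ) ≡ unvisited l ψ
  substitute-unvisited σ l {φ} eq =
    cong₂ (λ χ χ′ → □₁ (χ ⇒ χ′)) (substitute-marked σ (toℕ l))
      (trans (substitute-⋁ σ _)
             (⋁-cong (λ i → cong₂ (λ χ χ′ → □₀ (χ ⇒ χ′)) (substitute-marked σ (toℕ i)) (eq i))))

  fill : ∀ {R} → (Fin R → Fm) → ℕ → Fm
  fill {zero}  θ n       = ⊥′
  fill {suc R} θ zero    = θ zero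
  fill {suc R} θ (suc n) = fill (θ ∘ suc) n

  fill-vars : ∀ {R} (θ : Fin R → Fm) i → fill θ (toℕ i) ≡ θ i
  fill-vars θ zero    = refl
  fill-vars θ (suc i) = fill-vars (θ ∘ suc) i

  substitute-update : ∀ {R} (θ : Fin R → Fm) {f} → (∀ φ → substitute (fill θ) (f φ) ≡ f (substitute (fill θ) φ)) →
                      ∀ r i → substitute (fill θ) (F.updateAt vars r f i) ≡ F.updateAt θ r f i
  substitute-update θ {f} hom r i with i ≟ r
  ... | yes refl rewrite F.updateAt-updates r {f} (vars {_}) | F.updateAt-updates r {f} θ =
          trans (hom (vars r)) (cong f (fill-vars θ r))
  ... | no i≢r rewrite F.updateAt-minimal i r {f} vars i≢r | F.updateAt-minimal i r {f} θ i≢r = fill-vars θ i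

  numerals : ∀ {R} → Vec ℕ R → Fin R → Fm
  numerals ρ i = numeral (lookup ρ i)

  numerals-update : ∀ {R} (ρ : Vec ℕ R) r {f : Fm → Fm} {h : ℕ → ℕ} →
                    numeral (h (lookup ρ r)) ≡ f (numeral (lookup ρ r)) →
                    ∀ i → numerals (updateAt ρ r h) i ≡ F.updateAt (numerals ρ) r f i
  numerals-update ρ r {f} {h} eq i with i ≟ r
  ... | yes refl rewrite F.updateAt-updates r {f} (numerals ρ) | lookup∘updateAt r {h} ρ = eq
  ... | no i≢r rewrite F.updateAt-minimal i r {f} (numerals ρ) i≢r | lookup∘updateAt′ i r {h} i≢r ρ = refl

  -- A rejecting computation makes the axioms inconsistent

  module Refutation {R L : ℕ} (program : Vec (CounterInstruction (suc R) (suc L)) (suc L)) (x : ℕ) where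
    open CounterProgram program

    infix 3 ⊢_
    ⊢_ : Fm → Set
    ⊢_ = SmallestNormalLogic (axioms program x)

    Unvisited : State → Set
    Unvisited (l , ρ) = ⊢ unvisited l (numerals ρ)

    rule : ∀ {l c φ} → lookup program l ≡ c → φ ∈ rules l c → ⊢ φ
    rule {l} refl φ∈ = axiom (there (there (there (there (there
      (∈-concatMap⁺ (λ l → rules l (lookup program l)) (lose (∈-allFin l) φ∈)))))))

    backward : ∀ r (l : Fin (suc L)) f (l′ : Fin (suc L)) g (θ : Fin (suc R) → Fm) →
               (∀ σ φ → substitute σ (f φ) ≡ f (substitute σ φ)) →
               (∀ σ φ → substitute σ (g φ) ≡ g (substitute σ φ)) →
               ⊢ transition r l f l′ g →
               ⊢ unvisited l′ (F.updateAt θ r g) → ⊢ unvisited l (F.updateAt θ r f)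
    backward r l f l′ g θ f-hom g-hom ⊢t = modusPonens (subst ⊢_
      (cong₂ _⇒_ (substitute-unvisited (fill θ) l′ {F.updateAt vars r g} (substitute-update θ (g-hom (fill θ)) r))
                 (substitute-unvisited (fill θ) l {F.updateAt vars r f} (substitute-update θ (f-hom (fill θ)) r)))
      (substitution (fill θ) ⊢t))

    convert : ∀ (l : Fin (suc L)) {φ ψ : Fin (suc R) → Fm} → (∀ i → φ i ≡ ψ i) → ⊢ unvisited l φ → ⊢ unvisited l ψ
    convert l eq = subst ⊢_ (unvisited-cong l eq)

    -- The transition axioms are contrapositives, so derivability travels backwards along the
    -- computation.
    unvisited-next : ∀ s → Unvisited (next s) → Unvisited s
    unvisited-next (l , ρ) with lookup program l in eq
    ... | accept = id
    ... | reject = id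
    ... | add r n l′ =
          convert l (F.updateAt-id r (numerals ρ)) ∘
          backward r l id l′ (λ φ → fold φ S n) (numerals ρ)
            (λ _ _ → refl) (λ σ φ → substitute-fold σ S (λ _ → refl) n φ) (rule eq (here refl)) ∘
          convert l′ (numerals-update ρ r (fold-+ Z S n))
    ... | branch r l₀ l₁ with lookup ρ r in eq′
    ...   | zero =
            convert l (F.updateAt-id-local r (numerals ρ) Z≡) ∘
            backward r l (const Z) l₀ (const Z) (numerals ρ)
              (λ _ _ → refl) (λ _ _ → refl) (rule eq (here refl)) ∘
            convert l₀ (sym ∘ F.updateAt-id-local r (numerals ρ) Z≡)
      where
      Z≡ : Z ≡ numerals ρ r
      Z≡ = cong numeral (sym eq′)
    ...   | suc n =
            convert l restored ∘
            -- The schema is instantiated at the decremented contents, so that `S` restores the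
            -- current ones.
            backward r l S l₁ id (numerals ρ′)
              (λ _ _ → refl) (λ _ _ → refl) (rule eq (there (here refl))) ∘
            convert l₁ (sym ∘ F.updateAt-id r (numerals ρ′))
      where
      ρ′ = updateAt ρ r pred
      restored : ∀ i → F.updateAt (numerals ρ′) r S i ≡ numerals ρ i
      restored i = trans (sym (numerals-update ρ′ r {S} {suc} refl i))
        (cong (λ σ → numerals σ i) (trans (updateAt-updateAt r ρ)
          (updateAt-id-local r ρ (trans (cong (λ n → suc (pred n)) eq′) (sym eq′)))))

    unvisited-⟶* : ∀ {s t} → s ⟶* t → Unvisited t → Unvisited s
    unvisited-⟶* stop   u = u
    unvisited-⟶* (go d) u = unvisited-next _ (unvisited-⟶* d u)

    K′ : ∀ i {φ ψ} → ⊢ □ i (φ ⇒ ψ) → ⊢ □ i φ → ⊢ □ i ψ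
    K′ i {φ} {ψ} d e = modusPonens (modusPonens (substitution σ (K i)) d) e
      where
      σ : ℕ → Fm
      σ zero    = φ
      σ (suc _) = ψ

    -- The `reject` axiom, carried back along the run, shows the initial state to be unvisited. With
    -- `pointer x` under `□₂ □₁`, the instance of `start` at `numeral x` then yields `□₂ ⊥′`,
    -- against `serial`.
    inconsistent : ∀ {l ρ} → lookup program l ≡ reject →
                   (zero , x ∷ replicate R 0) ⟶* (l , ρ) → ∀ φ → ⊢ φ
    inconsistent {l} {ρ} eq d φ = modusPonens (tautologies (λ _ → refl)) ⊢⊥
      where
      initially : ⊢ unvisited (zero {L}) (input (numeral x))
      initially = convert zero input≡ (unvisited-⟶* d
        (subst ⊢_ (substitute-unvisited (fill (numerals ρ)) l {vars} (fill-vars (numerals ρ)))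
          (substitution (fill (numerals ρ)) (rule eq (here refl)))))
        where
        input≡ : ∀ i → numerals (x ∷ replicate R 0) i ≡ input (numeral x) i
        input≡ zero    = refl
        input≡ (suc i) = cong numeral (lookup-replicate i 0)

      started : ⊢ □₂ (unvisited (zero {L}) (input {R} (numeral x)) ⇒ □₁ (pointer x) ⇒ ⊥′)
      started = subst (λ χ → ⊢ □₂ (χ ⇒ □₁ (pointer x) ⇒ ⊥′))
        (substitute-unvisited (λ _ → numeral x) (zero {L}) {input (var 0)} input≡)
        (substitution (λ _ → numeral x) (axiom (there (there (there (there (here refl)))))))
        where
        input≡ : ∀ i → substitute (λ _ → numeral x) (input {R} (var 0) i) ≡ input (numeral x) i
        input≡ zero    = refl
        input≡ (suc i) = refl

      ⊢⊥ : ⊢ ⊥′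
      ⊢⊥ = modusPonens (axiom (there (there (there (here refl)))))
        (K′ _ (K′ _ started (necessity _ initially)) (necessity _ (necessity _ (axiom (here refl)))))

-- The model of an accepting computation

T-⇒⁺ : ∀ {a b} → (T a → T b) → T (not a or b)
T-⇒⁺ {true}  f = f tt
T-⇒⁺ {false} f = tt

T-⇒⁻ : ∀ {a b} → T (not a or b) → T a → T b
T-⇒⁻ {true} t _ = t

module Model (k : ℕ) {R L : ℕ} (program : Vec (CounterInstruction (suc R) (suc L)) (suc L)) (x : ℕ)
  (stage : ℕ → Maybe (CounterProgram.State program)) (T₀ : ℕ)
  (stage-first : stage T₀ ≡ just (zero , x ∷ replicate R 0))
  (stage-none : ∀ {n} → T₀ < n → stage n ≡ nothing)
  (stage-next : ∀ n {s} → stage n ≡ just s →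
                lookup program (proj₁ s) ≡ accept ⊎
                (∃[ n′ ] n ≡ suc n′ × stage n′ ≡ just (CounterProgram.next program s)))
  (stage-reject : ∀ n {s} → stage n ≡ just s → lookup program (proj₁ s) ≢ reject)
  where
  open CounterProgram program
  open Formulas k

  -- If n ≤ T₀, then spine n is the state with n steps to go; number i n is the
  -- number n as the content of register i.
  data World : Set where
    origin : World
    label  : ℕ → World
    number : (i n : ℕ) → World
    spine  : ℕ → World

  smaller : ℕ → ℕ → List World
  smaller i zero    = []
  smaller i (suc n) = number i n ∷ []

  registers : ∀ {m} → Vec ℕ m → List World
  registers ρ = tabulate (λ i → number (toℕ i) (lookup ρ i))

  registers⁺ : ∀ {m} (ρ : Vec ℕ m) i → number (toℕ i) (lookup ρ i) ∈ registers ρ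
  registers⁺ ρ i = ∈-tabulate⁺ i

  registers⁻ : ∀ {m} (ρ : Vec ℕ m) {u} → u ∈ registers ρ → ∃[ i ] u ≡ number (toℕ i) (lookup ρ i)
  registers⁻ ρ u∈ = ∈-tabulate⁻ u∈

  edgesOf : Maybe State → List World
  edgesOf nothing        = []
  edgesOf (just (l , ρ)) = label (toℕ l) ∷ registers ρ

  edges : World → List World
  edges origin       = number 0 x ∷ []
  edges (label n)    = []
  edges (number i n) = label i ∷ smaller i n
  edges (spine n)    = edgesOf (stage n)

  -- The relation of `□₁`. Labels form a chain above the origin, which lets ranks tell them apart.
  -- Numbers are seen from nowhere; they see the origin so that it stays the only world satisfying
  -- `source`.
  below : World → List World
  below origin          = []
  below (label zero)    = origin ∷ []
  below (label (suc n)) = label n ∷ below (label n)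
  below (number i n)    = origin ∷ []
  below (spine zero)    = origin ∷ []
  below (spine (suc n)) = spine n ∷ below (spine n)

  -- The admissible sets are those eventually constant along the spine; □₂ takes
  -- their limit.
  record Proposition : Set where
    field
      holds  : World → Bool
      bound  : ℕ
      limit  : Bool
      stable : ∀ {n} → bound ≤ n → holds (spine n) ≡ limit
  open Proposition

  falsum : Proposition
  falsum = record { holds = const false ; bound = 0 ; limit = false ; stable = λ _ → refl }

  implication : Proposition → Proposition → Proposition
  implication P Q = record
    { holds  = λ w → not (holds P w) or holds Q w
    ; bound  = bound P ⊔ bound Q
    ; limit  = not (limit P) or limit Q
    ; stable = λ le → cong₂ (λ a b → not a or b) (stable P (ℕ.≤-trans (ℕ.m≤m⊔n (bound P) (bound Q)) le))
                                              (stable Q (ℕ.≤-trans (ℕ.m≤n⊔m (bound P) (bound Q)) le))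
    }

  box : Fin (3 + k) → Proposition → Proposition
  box zero P = record
    { holds  = all (holds P) ∘ edges
    -- Beyond `T₀` the spine worlds have no edges, and every `□₀`-formula holds there vacuously.
    ; bound  = suc T₀
    ; limit  = true
    ; stable = λ le → cong (all (holds P) ∘ edgesOf) (stage-none le)
    }
  box (suc zero) P = record
    { holds  = all (holds P) ∘ below
    -- One more than the bound of `P`: then `spine (bound P)`, where `P` already has its limit
    -- value, is among the worlds below, and further spine worlds add nothing to the conjunction.
    ; bound  = suc (bound P)
    ; limit  = all (holds P) (below (spine (suc (bound P))))
    ; stable = λ le → walk _ (ℕ.m≤n⇒m<n∨m≡n le)
    }
    where
    N = bound P
    walk : ∀ n → suc N < n ⊎ suc N ≡ n → all (holds P) (below (spine n)) ≡ all (holds P) (below (spine (suc N)))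
    walk n (inj₂ refl) = refl
    walk (suc n) (inj₁ N<n) rewrite walk n (ℕ.m≤n⇒m<n∨m≡n (s≤s⁻¹ N<n))
                           | stable P (ℕ.≤-trans (ℕ.<⇒≤ (ℕ.n<1+n N)) (s≤s⁻¹ N<n))
                           | stable P (ℕ.≤-refl {N}) =
        trans (sym (Bool.∧-assoc (limit P) _ _)) (cong (_and all (holds P) (below (spine N))) (Bool.∧-idem (limit P)))
  box (suc (suc zero)) P = record
    { holds = const (limit P) ; bound = 0 ; limit = limit P ; stable = λ _ → refl }
  -- All further operators get the empty relation.
  box (suc (suc (suc _))) P = record
    { holds = const true ; bound = 0 ; limit = true ; stable = λ _ → refl }

  eval : (ℕ → Proposition) → Fm → Proposition
  eval e (var n) = e n
  eval e ⊥′      = falsum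
  eval e (φ ⇒ ψ) = implication (eval e φ) (eval e ψ)
  eval e (□ i φ) = box i (eval e φ)

  infix 4 _⊩_
  _⊩_ : World → Proposition → Set
  w ⊩ P = T (holds P w)

  Valid : Fm → Set
  Valid φ = ∀ e w → w ⊩ eval e φ

  ⊩-limit : ∀ P → (∀ n → T₀ < n → spine n ⊩ P) → T (limit P)
  ⊩-limit P valid = subst T (stable P (ℕ.m≤n⊔m (suc T₀) (bound P)))
    (valid (suc T₀ ⊔ bound P) (ℕ.m≤m⊔n (suc T₀) (bound P)))

  Valid⇒limit : ∀ {φ} → Valid φ → ∀ e → T (limit (eval e φ))
  Valid⇒limit {φ} valid e = ⊩-limit (eval e φ) (λ n _ → valid e (spine n))

  module _ (P : Proposition) where

    ⊩-all⁻ : ∀ {vs} → T (all (holds P) vs) → ∀ {u} → u ∈ vs → u ⊩ P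
    ⊩-all⁻ t = All.lookup (all⁺ (holds P) _ t)

    ⊩-all⁺ : ∀ {vs} → (∀ {u} → u ∈ vs → u ⊩ P) → T (all (holds P) vs)
    ⊩-all⁺ f = all⁻ (holds P) (All.tabulate f)

  -- Soundness of the model

  eval-substitute : ∀ σ e φ → eval e (substitute σ φ) ≡ eval (eval e ∘ σ) φ
  eval-substitute σ e (var n) = refl
  eval-substitute σ e ⊥′      = refl
  eval-substitute σ e (φ ⇒ ψ) = cong₂ implication (eval-substitute σ e φ) (eval-substitute σ e ψ)
  eval-substitute σ e (□ i φ) = cong (box i) (eval-substitute σ e φ)

  -- Truth at a fixed world is a valuation of the propositional atoms, so tautologies hold world by
  -- world.
  truth-eval : ∀ e w φ → truth (λ ψ → holds (eval e ψ) w) φ ≡ holds (eval e φ) w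
  truth-eval e w (var n) = refl
  truth-eval e w ⊥′      = refl
  truth-eval e w (φ ⇒ ψ) = cong₂ (λ a b → not a or b) (truth-eval e w φ) (truth-eval e w ψ)
  truth-eval e w (□ i φ) = refl

  distributive : ∀ P Q vs → T (all (holds (implication P Q)) vs) → T (all (holds P) vs) → T (all (holds Q) vs)
  distributive P Q vs t s = ⊩-all⁺ Q (λ u∈ → T-⇒⁻ (⊩-all⁻ (implication P Q) {vs} t u∈) (⊩-all⁻ P {vs} s u∈))

  Valid-K : ∀ i → Valid (axiomK i)
  Valid-K zero                e w = T-⇒⁺ λ t → T-⇒⁺ (distributive (e 0) (e 1) (edges w) t)
  Valid-K (suc zero)          e w = T-⇒⁺ λ t → T-⇒⁺ (distributive (e 0) (e 1) (below w) t)
  Valid-K (suc (suc zero))    e w = T-⇒⁺ λ t → T-⇒⁺ λ s → T-⇒⁻ {limit (e 0)} t s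
  Valid-K (suc (suc (suc _))) e w = tt

  Valid-□ : ∀ i φ → Valid φ → Valid (□ i φ)
  Valid-□ zero                φ valid e w = ⊩-all⁺ (eval e φ) {edges w} (λ _ → valid e _)
  Valid-□ (suc zero)          φ valid e w = ⊩-all⁺ (eval e φ) {below w} (λ _ → valid e _)
  Valid-□ (suc (suc zero))    φ valid e w = Valid⇒limit {φ} valid e
  Valid-□ (suc (suc (suc _))) φ valid e w = tt

  soundness : (∀ {φ} → φ ∈ axioms program x → Valid φ) →
              ∀ {φ} → SmallestNormalLogic (axioms program x) φ → Valid φ
  soundness valid = smallest-isLeast (axioms program x) (record
    { tautologies  = λ {φ} t e w → subst T (trans (sym (t _)) (truth-eval e w φ)) tt
    ; K            = Valid-K
    ; modusPonens  = λ s t e w → T-⇒⁻ (s e w) (t e w)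
    ; substitution = λ σ {φ} t e w → subst (λ P → w ⊩ P) (sym (eval-substitute σ e φ)) (t _ w)
    ; necessity    = λ i {φ} → Valid-□ i φ
    }) valid

  -- Every nonempty `below` list has the form `u ∷ below u`, so Löb's axiom follows by induction
  -- along finite chains.
  löb-step : ∀ P u → let Q = implication (box (suc zero) P) P in
             (T (all (holds Q) (below u)) → T (all (holds P) (below u))) →
             T (all (holds Q) (u ∷ below u)) → T (all (holds P) (u ∷ below u))
  löb-step P u hypothesis t with s , ts ← Equivalence.to T-∧ t =
    Equivalence.from T-∧ (T-⇒⁻ s (hypothesis ts) , hypothesis ts)

  löb-below : ∀ P w → T (all (holds (implication (box (suc zero) P) P)) (below w)) → T (all (holds P) (below w))
  löb-below P origin          = λ _ → tt
  löb-below P (label zero)    = löb-step P origin (λ _ → tt)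
  löb-below P (label (suc n)) = löb-step P (label n) (löb-below P (label n))
  löb-below P (number i n)    = löb-step P origin (λ _ → tt)
  löb-below P (spine zero)    = löb-step P origin (λ _ → tt)
  löb-below P (spine (suc n)) = löb-step P (spine n) (löb-below P (spine n))

  Valid-löb : Valid löb
  Valid-löb e w = T-⇒⁺ (löb-below (e 0) w)

  Valid-reflection : Valid reflection
  -- The limit of `□₁ p` is a conjunction whose first member, the value of `p` at its bound, equals
  -- the limit of `p`.
  Valid-reflection e _ rewrite stable (e 0) ℕ.≤-refl = project (limit (e 0)) _
    where
    project : ∀ a b → T (not (a and b) or a)
    project true  b = T-⇒⁺ {b} (λ _ → tt)
    project false b = tt

  Valid-serial : Valid serial
  Valid-serial e w = tt

  -- Validity of the axioms describing the computation

  module Semantics (e : ℕ → Proposition) where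

    infix 4 _⊨_
    _⊨_ : World → Fm → Set
    w ⊨ φ = w ⊩ eval e φ

    S⁺ : ∀ {i n φ} → number i n ⊨ φ → number i (suc n) ⊨ S φ
    S⁺ {i} {n} {φ} t = ⊩-all⁺ (eval e (guard ⇒ φ)) {edges (number i (suc n))}
      λ { (here refl) → tt ; (there (here refl)) → t }

    S⁻ : ∀ {i n φ} → number i (suc n) ⊨ S φ → number i n ⊨ φ
    S⁻ {i} {n} {φ} t = ⊩-all⁻ (eval e (guard ⇒ φ)) {edges (number i (suc n))} t (there (here refl))

    S-fold⁻ : ∀ {i n φ} k → number i (k + n) ⊨ fold φ S k → number i n ⊨ φ
    S-fold⁻ zero    t = t
    S-fold⁻ {i} {n} {φ} (suc k) t = S-fold⁻ {φ = φ} k (S⁻ {i} {k + n} {fold φ S k} t)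

    numeral-fails : ∀ {i} n → ¬ number i n ⊨ numeral n
    numeral-fails zero        ()
    numeral-fails {i} (suc n) t = numeral-fails n (S⁻ {i} {n} {numeral n} t)

    -- As the origin lies at the bottom, `label l` has rank 1 + l, and iterating `□₁` on `⊥′` bounds
    -- the rank.
    rank : ∀ m l → holds (eval e (fold ⊥′ □₁ (suc m))) (label l) ≡ (l <ᵇ m)
    rank zero    zero    = refl
    rank zero    (suc l) = refl
    rank (suc m) zero    = refl
    rank (suc m) (suc l) rewrite rank m l | rank (suc m) l = absorb l m
      where
      absorb : ∀ l m → (l <ᵇ m) and (l <ᵇ suc m) ≡ (l <ᵇ m)
      absorb zero    zero    = refl
      absorb zero    (suc m) = refl
      absorb (suc l) zero    = refl
      absorb (suc l) (suc m) = absorb l m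

    unlabelled⁺ : ∀ {l n} → l ≢ n → label l ⊨ unlabelled n
    unlabelled⁺ {l} {n} l≢n rewrite rank (suc n) l | rank n l =
      T-⇒⁺ λ t → ℕ.<⇒<ᵇ (ℕ.≤∧≢⇒< (s≤s⁻¹ (ℕ.<ᵇ⇒< l (suc n) t)) l≢n)

    unlabelled⁻ : ∀ {n} → ¬ label n ⊨ unlabelled n
    unlabelled⁻ {n} t rewrite rank (suc n) n | rank n n =
      ℕ.<-irrefl refl (ℕ.<ᵇ⇒< n n (T-⇒⁻ t (ℕ.<⇒<ᵇ (ℕ.n<1+n n))))

    marked⁺ : ∀ {n w} → label n ∈ edges w → w ⊨ marked n
    marked⁺ {n} l∈ = T-⇒⁺ λ t → unlabelled⁻ {n} (⊩-all⁻ (eval e (unlabelled n)) t l∈)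

    marked⁻ : ∀ {n w} → (∀ {u} → u ∈ edges w → u ⊨ unlabelled n) → ¬ w ⊨ marked n
    marked⁻ {n} {w} all t = T-⇒⁻ t (⊩-all⁺ (eval e (unlabelled n)) {edges w} all)

    marked-number⁻ : ∀ {i} n {m} → number i n ⊨ marked m → i ≡ m
    marked-number⁻ {i} n {m} t with i ℕ.≟ m
    ... | yes i≡m = i≡m
    ... | no  i≢m = ⊥-elim (marked⁻ {m} {number i n} (unlabelled-edge n) t)
      where
      unlabelled-edge : ∀ n {u} → u ∈ label i ∷ smaller i n → u ⊨ unlabelled m
      unlabelled-edge _       (here refl)         = unlabelled⁺ i≢m
      unlabelled-edge (suc n) (there (here refl)) = tt

    marked-spine⁻ : ∀ {j m} → spine j ⊨ marked m → ∃[ l ] ∃[ ρ ] (stage j ≡ just (l , ρ) × toℕ l ≡ m)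
    marked-spine⁻ {j} {m} t with stage j in eq
    ... | nothing = ⊥-elim t
    ... | just (l , ρ) with toℕ l ℕ.≟ m
    ...   | yes l≡m = l , ρ , refl , l≡m
    ...   | no  l≢m = ⊥-elim (T-⇒⁻ t (⊩-all⁺ (eval e (unlabelled m)) {edgesOf (just (l , ρ))} unlabelled-edge))
      where
      unlabelled-edge : ∀ {u} → u ∈ edgesOf (just (l , ρ)) → u ⊨ unlabelled m
      unlabelled-edge (here refl) = unlabelled⁺ l≢m
      unlabelled-edge (there u∈) with _ , refl ← registers⁻ ρ u∈ = tt

    -- The doubly negated form fits `Refutes`; its converse `⋁⁺` holds since truth at a world is
    -- Boolean.
    ⋁⁻ : ∀ {w n} (φ : Fin n → Fm) → w ⊨ ⋁ φ → ¬ (∀ i → ¬ w ⊨ φ i)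
    ⋁⁻ {n = zero}  φ t h = t
    ⋁⁻ {n = suc n} φ t h = ⋁⁻ (φ ∘ suc) (T-⇒⁻ t (T-⇒⁺ (h zero))) (h ∘ suc)

    ⋁⁺ : ∀ {w n} (φ : Fin n → Fm) → ¬ (∀ i → ¬ w ⊨ φ i) → w ⊨ ⋁ φ
    ⋁⁺ {n = zero}  φ h = h λ ()
    ⋁⁺ {n = suc n} φ h = T-⇒⁺ λ t → ⋁⁺ (φ ∘ suc) λ h′ → h λ where
      zero    → T-⇒⁻ t
      (suc i) → h′ i

    Refutes : ∀ {m} → (Fin m → Fm) → Vec ℕ m → Set
    Refutes φ ρ = ∀ i → ¬ number (toℕ i) (lookup ρ i) ⊨ φ i

    clause : (Fin (suc R) → Fm) → Fin (suc R) → Fm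
    clause φ i = □₀ (marked (toℕ i) ⇒ φ i)

    elsewhere : Fin (suc L) → (Fin (suc R) → Fm) → Fm
    elsewhere l φ = marked (toℕ l) ⇒ ⋁ (clause φ)

    -- Among the edges of a state, only the one to the content of register `i` leads to a world
    -- marked `i`: the label of the state has no edges itself. Hence clause `i` speaks of that
    -- content alone.
    elsewhere⁺ : ∀ l φ j → (∀ {ρ} → stage j ≡ just (l , ρ) → ¬ Refutes φ ρ) → spine j ⊨ elsewhere l φ
    elsewhere⁺ l φ j h = T-⇒⁺ λ t → conclude (marked-spine⁻ {j} t)
      where
      conclude : ∃[ l′ ] ∃[ ρ ] (stage j ≡ just (l′ , ρ) × toℕ l′ ≡ toℕ l) →
                 spine j ⊨ ⋁ (clause φ)
      conclude (l′ , ρ , eq , l′≡l) with refl ← toℕ-injective l′≡l =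
        ⋁⁺ {spine j} (clause φ) λ none → h eq λ i s → none i
          (⊩-all⁺ (eval e (marked (toℕ i) ⇒ φ i)) {edges (spine j)}
            λ u∈ → T-⇒⁺ (register i s (subst (λ st → _ ∈ edgesOf st) eq u∈)))
        where
        register : ∀ i {u} → number (toℕ i) (lookup ρ i) ⊨ φ i →
                   u ∈ edgesOf (just (l , ρ)) → u ⊨ marked (toℕ i) → u ⊨ φ i
        register i s (here refl) ()
        register i s (there u∈) m with i′ , refl ← registers⁻ ρ u∈
          with refl ← toℕ-injective {i = i′} {i} (marked-number⁻ (lookup ρ i′) m) = s

    elsewhere⁻ : ∀ {l φ j ρ} → spine j ⊨ elsewhere l φ → stage j ≡ just (l , ρ) → ¬ Refutes φ ρ
    elsewhere⁻ {l} {φ} {j} {ρ} t eq refutes =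
      ⋁⁻ {spine j} (clause φ) (T-⇒⁻ t (marked⁺ {w = spine j} (edge (here refl)))) λ i s →
        refutes i (T-⇒⁻ (⊩-all⁻ (eval e (marked (toℕ i) ⇒ φ i)) {edges (spine j)} s (edge (there (registers⁺ ρ i))))
                        (marked⁺ {w = number (toℕ i) (lookup ρ i)} (here refl)))
      where
      edge : ∀ {u} → u ∈ edgesOf (just (l , ρ)) → u ∈ edges (spine j)
      edge = subst (λ st → _ ∈ edgesOf st) (sym eq)

    -- The successor of a state lies just below it on the spine. As `below` is transitive, a world
    -- that sees the state also sees its successor. Worlds off the spine see no states.
    advance : ∀ l l′ φ φ′ →
      (∀ {j ρ} → stage j ≡ just (l , ρ) → Refutes φ ρ →
       ∃[ j′ ] ∃[ ρ′ ] (j ≡ suc j′ × stage j′ ≡ just (l′ , ρ′) × Refutes φ′ ρ′)) →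
      ∀ w → w ⊨ unvisited l′ φ′ → w ⊨ unvisited l φ
    advance l l′ φ φ′ h = walk
      where
      walk : ∀ w → w ⊨ unvisited l′ φ′ → w ⊨ unvisited l φ
      walk origin          t = tt
      walk (label zero)    t = tt
      walk (label (suc n)) t = Equivalence.from T-∧ (tt , walk (label n) (proj₂ (Equivalence.to T-∧ t)))
      walk (number i n)    t = tt
      walk (spine zero)    t = tt
      walk (spine (suc n)) t = Equivalence.from T-∧
        ( elsewhere⁺ l φ n (λ eq refutes → visit t (h eq refutes))
        , walk (spine n) (proj₂ (Equivalence.to T-∧ t)))
        where
        visit : ∀ {n} → spine (suc n) ⊨ unvisited l′ φ′ →
                ¬ (∃[ j′ ] ∃[ ρ′ ] (n ≡ suc j′ × stage j′ ≡ just (l′ , ρ′) × Refutes φ′ ρ′))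
        visit t (j′ , ρ′ , refl , eq , refutes) =
          elsewhere⁻ {l′} {φ′}
            (⊩-all⁻ (eval e (elsewhere l′ φ′)) {below (spine (suc (suc j′)))} t (there (here refl)))
            eq refutes

    never : ∀ l φ → (∀ {j ρ} → stage j ≢ just (l , ρ)) → ∀ w → w ⊨ unvisited l φ
    never l φ h = walk
      where
      walk : ∀ w → w ⊨ unvisited l φ
      walk origin          = tt
      walk (label zero)    = tt
      walk (label (suc n)) = Equivalence.from T-∧ (tt , walk (label n))
      walk (number i n)    = tt
      walk (spine zero)    = tt
      walk (spine (suc n)) = Equivalence.from T-∧ (elsewhere⁺ l φ n (λ eq _ → h eq) , walk (spine n))

    refutes-update : ∀ r f g h (ρ : Vec ℕ (suc R)) →
      (number (toℕ r) (h (lookup ρ r)) ⊨ g (vars r) → number (toℕ r) (lookup ρ r) ⊨ f (vars r)) →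
      Refutes (F.updateAt vars r f) ρ → Refutes (F.updateAt vars r g) (updateAt ρ r h)
    refutes-update r f g h ρ back refutes i with i ≟ r | refutes i
    ... | yes refl | q rewrite F.updateAt-updates r {f} (vars {suc R}) | F.updateAt-updates r {g} (vars {suc R})
                             | lookup∘updateAt r {h} ρ = q ∘ back
    ... | no i≢r   | q rewrite F.updateAt-minimal i r {f} (vars {suc R}) i≢r
                             | F.updateAt-minimal i r {g} (vars {suc R}) i≢r
                             | lookup∘updateAt′ i r {h} i≢r ρ = q

    successor : ∀ {j l ρ} → stage j ≡ just (l , ρ) → lookup program l ≢ accept →
                ∃[ j′ ] (j ≡ suc j′ × stage j′ ≡ just (next (l , ρ)))
    successor {j} eq l≢ with stage-next j eq
    ... | inj₁ l≡ = contradiction l≡ l≢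
    ... | inj₂ s  = s

    transition-valid : ∀ {r l f l′ g c} → lookup program l ≡ c → c ≢ accept →
      (∀ ρ → Refutes (F.updateAt vars r f) ρ →
       ∃[ ρ′ ] (run c (l , ρ) ≡ (l′ , ρ′) × Refutes (F.updateAt vars r g) ρ′)) →
      ∀ w → w ⊨ transition r l f l′ g
    transition-valid {r} {l} {f} {l′} {g} refl c≢ h w =
      T-⇒⁺ (advance l l′ (F.updateAt vars r f) (F.updateAt vars r g) move w)
      where
      move : ∀ {j ρ} → stage j ≡ just (l , ρ) → Refutes (F.updateAt vars r f) ρ →
             ∃[ j′ ] ∃[ ρ′ ] (j ≡ suc j′ × stage j′ ≡ just (l′ , ρ′) × Refutes (F.updateAt vars r g) ρ′)
      move {j} {ρ} eq refutes with j′ , j≡ , eq′ ← successor eq c≢ | ρ′ , next≡ , refutes′ ← h ρ refutes =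
        j′ , ρ′ , j≡ , trans eq′ (cong just next≡) , refutes′

    rule-valid : ∀ l c → lookup program l ≡ c → ∀ {φ} → φ ∈ rules l c → ∀ w → w ⊨ φ
    rule-valid l (add r n l′) eq (here refl) =
      transition-valid {r} {l} {id} {l′} {λ φ → fold φ S n} eq (λ ()) λ ρ refutes →
        updateAt ρ r (n +_) , refl ,
        refutes-update r id (λ φ → fold φ S n) (n +_) ρ (S-fold⁻ {φ = vars r} n) refutes
    rule-valid l (branch r l₀ l₁) eq (here refl) =
      transition-valid {r} {l} {const Z} {l₀} {const Z} eq (λ ()) λ ρ refutes → ρ , zero-branch ρ refutes , refutes
      where
      zero-branch : ∀ ρ → Refutes (F.updateAt vars r (const Z)) ρ → run (branch r l₀ l₁) (l , ρ) ≡ (l₀ , ρ)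
      zero-branch ρ refutes with lookup ρ r | refutes r
      ... | zero  | _ = refl
      -- At a positive number `Z` holds and so cannot be refuted.
      ... | suc n | q rewrite F.updateAt-updates r {const Z} (vars {suc R}) = ⊥-elim (q tt)
    rule-valid l (branch r l₀ l₁) eq (there (here refl)) =
      transition-valid {r} {l} {S} {l₁} {id} eq (λ ()) λ ρ refutes →
        updateAt ρ r pred , suc-branch ρ refutes ,
        refutes-update r S id pred ρ (pred⁺ (lookup ρ r)) refutes
      where
      pred⁺ : ∀ n → number (toℕ r) (pred n) ⊨ vars r → number (toℕ r) n ⊨ S (vars r)
      pred⁺ zero    t = tt
      pred⁺ (suc n) t = S⁺ {φ = vars r} t
      suc-branch : ∀ ρ → Refutes (F.updateAt vars r S) ρ → run (branch r l₀ l₁) (l , ρ) ≡ (l₁ , updateAt ρ r pred)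
      suc-branch ρ refutes with lookup ρ r | refutes r
      ... | suc _ | _ = refl
      ... | zero  | q rewrite F.updateAt-updates r {S} (vars {suc R}) = ⊥-elim (q tt)
    rule-valid l reject eq (here refl) = never l vars (λ {j} eq′ → stage-reject j eq′ eq)

    origin∈below : ∀ n → origin ∈ below (spine n)
    origin∈below zero    = here refl
    origin∈below (suc n) = there (origin∈below n)

    spine∈below : ∀ {m} n → m < n → spine m ∈ below (spine n)
    spine∈below (suc n) m<n with ℕ.m≤n⇒m<n∨m≡n (s≤s⁻¹ m<n)
    ... | inj₁ m<n′ = there (spine∈below n m<n′)
    ... | inj₂ refl = here refl

    -- Only spine worlds beyond `T₀` matter for the limit, and these see both the initial state and
    -- the origin.
    start-valid : ∀ w → w ⊨ start R (zero {L})
    start-valid w = ⊩-limit (eval e (premise ⇒ □₁ (S (var 0) ⇒ ~ source) ⇒ ⊥′)) λ n T₀<n →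
      T-⇒⁺ λ t → T-⇒⁺ λ s → elsewhere⁻ {zero} {input (var 0)}
        (⊩-all⁻ (eval e (elsewhere zero (input (var 0)))) {below (spine n)} t (spine∈below n T₀<n))
        stage-first (refutes n s)
      where
      premise = unvisited (zero {L}) (input {R} (var 0))
      refutes : ∀ n → spine n ⊨ □₁ (S (var 0) ⇒ ~ source) → Refutes (input (var 0)) (x ∷ replicate R 0)
      refutes n s zero    t = T-⇒⁻ (⊩-all⁻ (eval e (S (var 0) ⇒ ~ source)) {below (spine n)} s (origin∈below n))
        (⊩-all⁺ (eval e (guard ⇒ var 0)) {edges origin} λ { (here refl) → t })
      refutes n s (suc i) rewrite lookup-replicate i 0 = λ ()

    -- Away from the origin `source` fails because some world lies below; at the origin the only
    -- edge leads to the number `x`, where `numeral x` fails.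
    pointer-valid : ∀ w → w ⊨ pointer x
    pointer-valid origin          = T-⇒⁺ λ t → numeral-fails x
      (⊩-all⁻ (eval e (guard ⇒ numeral x)) {edges origin} t (here refl))
    pointer-valid w@(label zero)    = T-⇒⁺ {holds (eval e (numeral (suc x))) w} λ _ → tt
    pointer-valid w@(label (suc _)) = T-⇒⁺ {holds (eval e (numeral (suc x))) w} λ _ → tt
    pointer-valid w@(number _ _)    = T-⇒⁺ {holds (eval e (numeral (suc x))) w} λ _ → tt
    pointer-valid w@(spine zero)    = T-⇒⁺ {holds (eval e (numeral (suc x))) w} λ _ → tt
    pointer-valid w@(spine (suc _)) = T-⇒⁺ {holds (eval e (numeral (suc x))) w} λ _ → tt

  axiom-valid : ∀ {φ} → φ ∈ axioms program x → Valid φ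
  axiom-valid (here refl)                                 e = Semantics.pointer-valid e
  axiom-valid (there (here refl))                         e = Valid-löb e
  axiom-valid (there (there (here refl)))                 e = Valid-reflection e
  axiom-valid (there (there (there (here refl))))         e = Valid-serial e
  axiom-valid (there (there (there (there (here refl))))) e = Semantics.start-valid e
  axiom-valid (there (there (there (there (there φ∈)))))  e
    with l , _ , φ∈rules ← find (∈-concatMap⁻ (λ l → rules l (lookup program l)) {xs = allFin (suc L)} φ∈) =
      Semantics.rule-valid e l _ refl φ∈rules

  consistent : ¬ SmallestNormalLogic (axioms program x) ⊥′
  consistent d = soundness axiom-valid d (λ _ → falsum) origin

-- Diagonalisation

module _ (k : ℕ) {R L : ℕ} (program : Vec (CounterInstruction (suc R) (suc L)) (suc L)) (x : ℕ) where
  open CounterProgram program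
  open Formulas k

  accepting⇒consistent : ∀ {l ρ} → lookup program l ≡ accept → (zero , x ∷ replicate R 0) ⟶* (l , ρ) →
                         ¬ SmallestNormalLogic (axioms program x) ⊥′
  accepting⇒consistent {l} {ρ} l-accept d =
    Model.consistent k program x stage T₀ stage-first stage-none stage-next stage-reject
    where
    after : ℕ → State
    after = fold (zero , x ∷ replicate R 0) next

    T₀ : ℕ
    T₀ = proj₁ (⟶*⇒iterate d)

    final : after T₀ ≡ (l , ρ)
    final = trans (iterate-is-fold _ next T₀) (proj₂ (⟶*⇒iterate d))

    stage : ℕ → Maybe State
    stage n with n ℕ.≤? T₀
    ... | yes _ = just (after (T₀ ∸ n))
    ... | no  _ = nothing

    stage-≤ : ∀ {n} → n ≤ T₀ → stage n ≡ just (after (T₀ ∸ n))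
    stage-≤ {n} n≤ with n ℕ.≤? T₀
    ... | yes _  = refl
    ... | no  n≰ = contradiction n≤ n≰

    stage-none : ∀ {n} → T₀ < n → stage n ≡ nothing
    stage-none {n} T₀<n with n ℕ.≤? T₀
    ... | yes n≤ = contradiction n≤ (ℕ.<⇒≱ T₀<n)
    ... | no  _  = refl

    stage⁻ : ∀ n {s} → stage n ≡ just s → n ≤ T₀ × after (T₀ ∸ n) ≡ s
    stage⁻ n eq with n ℕ.≤? T₀
    stage⁻ n refl | yes n≤ = n≤ , refl

    stage-first : stage T₀ ≡ just (zero , x ∷ replicate R 0)
    stage-first = trans (stage-≤ ℕ.≤-refl) (cong (λ n → just (after n)) (ℕ.n∸n≡0 T₀))

    stage-next : ∀ n {s} → stage n ≡ just s →
                 lookup program (proj₁ s) ≡ accept ⊎ (∃[ n′ ] n ≡ suc n′ × stage n′ ≡ just (next s))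
    stage-next n eq with stage⁻ n eq
    stage-next zero    eq | _ , refl = inj₁ (subst (λ s → lookup program (proj₁ s) ≡ accept) (sym final) l-accept)
    stage-next (suc n) eq | n< , refl = inj₂ (n , refl ,
      trans (stage-≤ (ℕ.<⇒≤ n<)) (cong (λ m → just (after m)) (ℕ.+-∸-assoc 1 n<)))

    accept≢reject : accept {suc R} {suc L} ≢ reject
    accept≢reject ()

    -- A rejecting state is a fixed point of `next`; had it occurred, the run would have ended in it
    -- rather than in the accepting state.
    stage-reject : ∀ n {s} → stage n ≡ just s → lookup program (proj₁ s) ≢ reject
    stage-reject n eq s-reject with stage⁻ n eq
    ... | n≤ , refl = accept≢reject (trans (sym l-accept)
      (trans (cong (λ t → lookup program (proj₁ t)) (trans (sym final) stuck)) s-reject))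
      where
      s = after (T₀ ∸ n)
      fixed : ∀ m → fold s next m ≡ s
      fixed zero    = refl
      fixed (suc m) = trans (cong next (fixed m)) (cong (λ c → run c s) s-reject)
      stuck : after T₀ ≡ s
      stuck = trans (cong after (sym (ℕ.m+[n∸m]≡n n≤))) (trans (fold-+ _ next n) (fixed n))

-- 𝒱-completeness and consistency

module _ {k} (c ℓ p : Level) (Γ : List (Formula (3 + k))) where

  -- The empty class validates every formula.
  inconsistent⇒𝒱-complete : (∀ φ → SmallestNormalLogic Γ φ) → 𝒱-Complete c ℓ p (SmallestNormalLogic Γ)
  inconsistent⇒𝒱-complete ⊢ = (λ _ → Lift p Empty) , λ φ → mk⇔ (λ { _ _ (lift ()) }) (λ _ → ⊢ φ)

  -- By `degenerate`, all algebras of a class determining the logic are trivial and so validate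
  -- `⊥′`.
  consistent⇒¬𝒱-complete : SmallestNormalLogic Γ löb → SmallestNormalLogic Γ reflection →
                             SmallestNormalLogic Γ serial → ¬ SmallestNormalLogic Γ ⊥′ →
                             ¬ 𝒱-Complete c ℓ p (SmallestNormalLogic Γ)
  consistent⇒¬𝒱-complete ⊢löb ⊢reflection ⊢serial consistent (𝒦 , complete) =
    consistent (Equivalence.from (complete ⊥′) λ A A∈𝒦 v →
      𝒱-BAO.sym A (degenerate A (valid ⊢löb A A∈𝒦) (valid ⊢reflection A A∈𝒦) (valid ⊢serial A A∈𝒦)))
    where
    valid : ∀ {φ} → SmallestNormalLogic Γ φ → ∀ A → 𝒦 A → 𝒱-BAO.Validates A φ
    valid {φ} = Equivalence.to (complete φ)

-- Codes are towers of exponentials. The coding is therefore kept abstract, lest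
-- the type checker attempt to evaluate them.
module Diagonal (k : ℕ) (M : Machine)
  (codeFm : Formula (3 + k) → ℕ) (codeList : List (Formula (3 + k)) → ℕ)
  (codeFm-□-⇒ : ∀ φ ψ → codeFm (□ zero (φ ⇒ ψ)) ≡ (20 + 32 * 2 ^ codeFm φ) + codeFm ψ * (64 * 2 ^ codeFm φ))
  (codeList-⇒-∷ : ∀ φ ψ Γ → codeList ((φ ⇒ ψ) ∷ Γ) ≡ ⟨ ⟨ 1 , ⟨ codeFm φ , codeFm ψ ⟩ ⟩ , codeList Γ ⟩)
  (c ℓ p : Level)
  (decides : ∀ Γ → (𝒱-Complete c ℓ p (SmallestNormalLogic Γ) → Machine._↦_ M (codeList Γ) 1) ×
                   (¬ 𝒱-Complete c ℓ p (SmallestNormalLogic Γ) → Machine._↦_ M (codeList Γ) 0))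
  where
  open Formulas k
  open Machine M using (_↦_)

  -- The code of `S ψ` is an affine function of the code of `ψ`; these are its coefficients.
  α β : ℕ
  α = 64 * 2 ^ codeFm guard
  β = 20 + 32 * 2 ^ codeFm guard

  open FrontEnd M (codeFm (numeral 1)) α β (codeFm (~ source))

  codeFm-numeral : ∀ n → codeFm (numeral (suc n)) ≡ b n
  codeFm-numeral zero    = refl
  codeFm-numeral (suc n) = trans (codeFm-□-⇒ guard (numeral (suc n))) (cong (λ i → β + i * α) (codeFm-numeral n))

  -- There is no circularity: the constants in `simulation` are codes of, or computed from codes of,
  -- `numeral 1`, `guard` and `~ source`, none of which involves `x`.
  x : ℕ
  x = codeList (background simulation)

  Γ : List Fm
  Γ = axioms simulation x

  codeList-Γ : codeList Γ ≡ ⟨ ⟨ 1 , ⟨ b x , codeFm (~ source) ⟩ ⟩ , x ⟩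
  codeList-Γ = trans (codeList-⇒-∷ (numeral (suc x)) (~ source) (background simulation))
    (cong (λ i → ⟨ ⟨ 1 , ⟨ i , codeFm (~ source) ⟩ ⟩ , x ⟩) (codeFm-numeral x))

  complete : codeList Γ ↦ 0 → 𝒱-Complete c ℓ p (SmallestNormalLogic Γ)
  complete rejected = inconsistent⇒𝒱-complete c ℓ p Γ
    (Refutation.inconsistent simulation x refl (proj₂ (reaches-verdict codeList-Γ rejected)))

  incomplete : ¬ 𝒱-Complete c ℓ p (SmallestNormalLogic Γ)
  incomplete is-complete =
    consistent⇒¬𝒱-complete c ℓ p Γ (axiom (there (here refl))) (axiom (there (there (here refl))))
      (axiom (there (there (there (here refl)))))
      (accepting⇒consistent k simulation x refl
        (proj₂ (reaches-verdict codeList-Γ (proj₁ (decides Γ) is-complete))))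
      is-complete

  -- Since `incomplete` holds outright, `M` has to answer 0; but this answer makes the logic
  -- inconsistent and hence complete.
  undecidable : Empty
  undecidable = incomplete (complete (proj₂ (decides Γ) incomplete))

code-□-⇒ : ∀ {k} (φ ψ : Formula (suc k)) → codeFormula (□ zero (φ ⇒ ψ)) ≡
           (20 + 32 * 2 ^ codeFormula φ) + codeFormula ψ * (64 * 2 ^ codeFormula φ)
code-□-⇒ φ ψ = lemma (2 ^ codeFormula φ) (codeFormula ψ)
  where
  lemma : ∀ q n → 4 * (1 + 2 * (2 * (1 + 2 * (q * (1 + 2 * n))))) ≡ (20 + 32 * q) + n * (64 * q)
  lemma = solve-∀

corollary6p6 : (c ℓ p : Level) (k : ℕ) → k ≥ 3 →
    ¬ (∃[ M ] Decides {k} M (λ Γ → 𝒱-Complete c ℓ p (SmallestNormalLogic Γ)))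
corollary6p6 c ℓ p _ (s≤s (s≤s (s≤s (z≤n {k})))) (M , decides) =
  Diagonal.undecidable k M codeFormula code code-□-⇒ (λ _ _ _ → refl) c ℓ p decides
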